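{- Let $\mathcal{L}$ be a monadic abstract logic such that $\mathcal{L}^{1- }_{\omega\omega}\leq\mathcal{L}$. If $\mathcal{L}$ satisfies the compactness property and the weak isomorphism property, then $\mathcal{L}\leq\mathcal{L}^{1- }_{\omega\omega}$.
   Context: A monadic logic is one whose vocabularies consist only of unary relation symbols; $\mathcal{L}^{1- }_{\omega\omega}$ denotes first-order logic without identity restricted to such monadic vocabularies. An abstract logic $\mathcal{L}$ assigns to each vocabulary $\tau$ a set of sentences $\mathcal{L}(\tau)$ and a satisfaction relation with $\tau$-structures, satisfying the basic closure properties of abstract logics in the sense of Barwise–Feferman (isomorphism, reduct/expansion, renaming, closure under Boolean connectives, etc.), with the atom property taken relative to identity-free first-order logic; relativization is not required. $\mathcal{L}\leq\mathcal{L}'$ means that for every vocabulary $\tau$ every sentence of $\mathcal{L}(\tau)$ is equivalent to some sentence of $\mathcal{L}'(\tau)$. Compactness property: for every $\tau$ and $\Phi\subseteq\mathcal{L}(\tau)$, if every finite subset of $\Phi$ has a model then $\Phi$ has a model. A weak isomorphism between $\tau$-structures $\mathfrak{A},\mathfrak{B}$ (for monadic $\tau$) is a relation $R\subseteq A\times B$ with domain $A$ and range $B$ such that whenever $aRb$, $P^{\mathfrak{A}}(a)$ iff $P^{\mathfrak{B}}(b)$ for each $P\in\tau$; $\mathfrak{A}\sim\mathfrak{B}$ means such $R$ exists. Weak isomorphism property: $\mathfrak{A}\sim\mathfrak{B}$ implies $\mathfrak{A}$ and $\mathfrak{B}$ satisfy the same $\mathcal{L}$-sentences. -}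

module Defs where

open import Level using (Level; suc; _⊔_; Lift; lift; lower)
open import Data.Nat.Base using (ℕ)
open import Data.Fin.Base using (Fin) renaming (zero to fzero; suc to fsuc)
open import Data.Vec.Base using (Vec; []; _∷_; lookup)
open import Data.List.Base using (List)
open import Data.List.Relation.Unary.All using (All)
open import Data.Empty.Polymorphic using (⊥)
open import Data.Product.Base using (Σ-syntax; ∃-syntax; _×_; _,_; proj₁; proj₂)
open import Data.Product.Function.NonDependent.Propositional using (_×-⇔_)
open import Data.Sum.Base using (_⊎_)
open import Data.Sum.Function.Propositional using (_⊎-⇔_)
open import Function.Base using (_∘_)
open import Function.Bundles using (_⇔_; mk⇔; _↔_; _↣_; module Equivalence; module Inverse; module Injection)
open import Function.Properties.Equivalence using () renaming (refl to ⇔-refl)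
open import Function.Related.TypeIsomorphisms using (→-cong-⇔)
open import Relation.Binary.Core using (REL)
open import Relation.Binary.PropositionalEquality using (_≡_; refl)
open import Relation.Nullary using (¬_)
open import Relation.Unary using (Pred; _∈_)

private
  variable
    u s r s′ r′ : Level
    n : ℕ

-- The "sets" of the metatheory (symbols of a vocabulary, domains of
-- structures) are the types of one universe, Set u.  A monadic vocabulary is
-- given by its type of unary relation symbols.
Vocabulary : (u : Level) → Set (suc u)
Vocabulary u = Set u

private
  variable
    σ τ : Vocabulary u

-- Domains are nonempty.  The witness `point` is not part of the signature:
-- isomorphisms and weak isomorphisms below ignore it.
record Structure {u : Level} (τ : Vocabulary u) : Set (suc u) where
  field
    Dom    : Set u
    point  : Dom
    interp : τ → Pred Dom u

open Structure public

record _≅_ {u : Level} {τ : Vocabulary u} (𝔄 𝔅 : Structure τ) : Set u where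
  field
    bijection : Dom 𝔄 ↔ Dom 𝔅
    preserves : ∀ P a → interp 𝔄 P a ⇔ interp 𝔅 P (Inverse.to bijection a)

record IsWeakIsomorphism {u : Level} {τ : Vocabulary u} (𝔄 𝔅 : Structure τ)
                         (R : REL (Dom 𝔄) (Dom 𝔅) u) : Set u where
  field
    total      : ∀ a → ∃[ b ] R a b
    surjective : ∀ b → ∃[ a ] R a b
    preserves  : ∀ {a b} → R a b → ∀ P → interp 𝔄 P a ⇔ interp 𝔅 P b

_∼_ : {τ : Vocabulary u} → Structure τ → Structure τ → Set (suc u)
_∼_ {u} 𝔄 𝔅 = Σ[ R ∈ REL (Dom 𝔄) (Dom 𝔅) u ] IsWeakIsomorphism 𝔄 𝔅 R

-- An injection ρ : σ ↣ τ plays the role of both an inclusion σ ⊆ τ and a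
-- renaming of symbols; in either case this is the σ-reduct of 𝔄 along ρ.
reduct : {σ τ : Vocabulary u} → σ ↣ τ → Structure τ → Structure σ
reduct ρ 𝔄 = record
  { Dom    = Dom 𝔄
  ; point  = point 𝔄
  ; interp = interp 𝔄 ∘ Injection.to ρ
  }

-- Identity-free first-order formulas with free variables among the de Bruijn
-- indices in Fin n.  Falsum is primitive: without it (and without identity)
-- the empty vocabulary would have no sentences at all.
data Formula {u : Level} (τ : Vocabulary u) : ℕ → Set u where
  atom        : τ → Fin n → Formula τ n
  falsum      : Formula τ n
  _∧′_ _∨′_ _⇒′_ : Formula τ n → Formula τ n → Formula τ n
  ∀′ ∃′       : Formula τ (ℕ.suc n) → Formula τ n

FOSentence : Vocabulary u → Set u
FOSentence τ = Formula τ 0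

data Atomic {u : Level} {τ : Vocabulary u} {n : ℕ} : Pred (Formula τ n) u where
  atom   : ∀ P x → Atomic (atom P x)
  falsum : Atomic falsum

Sat : {τ : Vocabulary u} (𝔄 : Structure τ) → Vec (Dom 𝔄) n → Formula τ n → Set u
Sat 𝔄 e (atom P x) = interp 𝔄 P (lookup e x)
Sat 𝔄 e falsum     = ⊥
Sat 𝔄 e (φ ∧′ ψ)   = Sat 𝔄 e φ × Sat 𝔄 e ψ
Sat 𝔄 e (φ ∨′ ψ)   = Sat 𝔄 e φ ⊎ Sat 𝔄 e ψ
Sat 𝔄 e (φ ⇒′ ψ)   = Sat 𝔄 e φ → Sat 𝔄 e ψ
Sat 𝔄 e (∀′ φ)     = ∀ a → Sat 𝔄 (a ∷ e) φ
Sat 𝔄 e (∃′ φ)     = ∃[ a ] Sat 𝔄 (a ∷ e) φ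

_⊨FO_ : {τ : Vocabulary u} → Structure τ → FOSentence τ → Set u
𝔄 ⊨FO φ = Sat 𝔄 [] φ

-- Particularization is usually phrased with constant symbols, which monadic
-- vocabularies do not have, so there is no such clause.  For the same reason
-- the only atomic sentence is falsum.
record MonadicLogic (u s r : Level) : Set (suc (u ⊔ s ⊔ r)) where
  infix 4 _⊨_
  field
    Sentence : Vocabulary u → Set s
    _⊨_      : {τ : Vocabulary u} → Structure τ → Sentence τ → Set r

    isomorphism : {τ : Vocabulary u} {𝔄 𝔅 : Structure τ} → 𝔄 ≅ 𝔅 →
                  (φ : Sentence τ) → 𝔄 ⊨ φ ⇔ 𝔅 ⊨ φ
    -- the reduct (expansion) and renaming properties together
    translation : {σ τ : Vocabulary u} (ρ : σ ↣ τ) (φ : Sentence σ) →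
                  ∃[ ψ ] (∀ (𝔄 : Structure τ) → 𝔄 ⊨ ψ ⇔ reduct ρ 𝔄 ⊨ φ)
    atoms       : {τ : Vocabulary u} (φ : FOSentence τ) → Atomic φ →
                  ∃[ ψ ] (∀ (𝔄 : Structure τ) → 𝔄 ⊨ ψ ⇔ 𝔄 ⊨FO φ)
    negation    : {τ : Vocabulary u} (φ : Sentence τ) →
                  ∃[ ψ ] (∀ (𝔄 : Structure τ) → 𝔄 ⊨ ψ ⇔ (¬ 𝔄 ⊨ φ))
    conjunction : {τ : Vocabulary u} (φ₁ φ₂ : Sentence τ) →
                  ∃[ ψ ] (∀ (𝔄 : Structure τ) → 𝔄 ⊨ ψ ⇔ (𝔄 ⊨ φ₁ × 𝔄 ⊨ φ₂))
    disjunction : {τ : Vocabulary u} (φ₁ φ₂ : Sentence τ) →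
                  ∃[ ψ ] (∀ (𝔄 : Structure τ) → 𝔄 ⊨ ψ ⇔ (𝔄 ⊨ φ₁ ⊎ 𝔄 ⊨ φ₂))

infix 4 _≤_

_≤_ : MonadicLogic u s r → MonadicLogic u s′ r′ → Set (suc u ⊔ s ⊔ r ⊔ s′ ⊔ r′)
_≤_ {u} L L′ = (τ : Vocabulary u) (φ : L.Sentence τ) →
  Σ[ ψ ∈ L′.Sentence τ ] (∀ (𝔄 : Structure τ) → 𝔄 L.⊨ φ ⇔ 𝔄 L′.⊨ ψ)
  where
  module L  = MonadicLogic L
  module L′ = MonadicLogic L′

module _ {u s r : Level} (L : MonadicLogic u s r) where
  open MonadicLogic L

  HasModel : {ℓ : Level} {τ : Vocabulary u} → Pred (Sentence τ) ℓ → Set (suc u ⊔ s ⊔ r ⊔ ℓ)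
  HasModel {τ = τ} Φ = Σ[ 𝔄 ∈ Structure τ ] (∀ φ → φ ∈ Φ → 𝔄 ⊨ φ)

  -- Finite subsets are given by finite lists of elements of Φ.
  CompactnessProperty : Set (suc (u ⊔ s) ⊔ r)
  CompactnessProperty =
    (τ : Vocabulary u) (Φ : Pred (Sentence τ) (u ⊔ s)) →
    ((Φ₀ : List (Sentence τ)) → All (_∈ Φ) Φ₀ →
       Σ[ 𝔄 ∈ Structure τ ] All (𝔄 ⊨_) Φ₀) →
    HasModel Φ

  WeakIsomorphismProperty : Set (suc u ⊔ s ⊔ r)
  WeakIsomorphismProperty =
    (τ : Vocabulary u) (𝔄 𝔅 : Structure τ) → 𝔄 ∼ 𝔅 →
    (φ : Sentence τ) → 𝔄 ⊨ φ ⇔ 𝔅 ⊨ φ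

≅⇒∼ : {τ : Vocabulary u} {𝔄 𝔅 : Structure τ} → 𝔄 ≅ 𝔅 → 𝔄 ∼ 𝔅
≅⇒∼ i = (λ a b → to a ≡ b) , record
  { total      = λ a → to a , refl
  ; surjective = λ b → from b , strictlyInverseˡ b
  ; preserves  = λ { {a} refl P → preserves P a }
  }
  where
  open _≅_ i
  open Inverse bijection

module _ {u : Level} {τ : Vocabulary u} {𝔄 𝔅 : Structure τ}
         {R : REL (Dom 𝔄) (Dom 𝔅) u} (W : IsWeakIsomorphism 𝔄 𝔅 R) where
  open IsWeakIsomorphism W
  open Equivalence

  private
    extend : {e : Vec (Dom 𝔄) n} {f : Vec (Dom 𝔅) n} {a : Dom 𝔄} {b : Dom 𝔅} →
             R a b → (∀ x → R (lookup e x) (lookup f x)) →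
             ∀ x → R (lookup (a ∷ e) x) (lookup (b ∷ f) x)
    extend Rab Ref fzero    = Rab
    extend Rab Ref (fsuc x) = Ref x

  Sat-∼ : (φ : Formula τ n) {e : Vec (Dom 𝔄) n} {f : Vec (Dom 𝔅) n} →
          (∀ x → R (lookup e x) (lookup f x)) → Sat 𝔄 e φ ⇔ Sat 𝔅 f φ
  Sat-∼ (atom P x) Ref = preserves (Ref x) P
  Sat-∼ falsum     Ref = ⇔-refl
  Sat-∼ (φ ∧′ ψ)   Ref = Sat-∼ φ Ref ×-⇔ Sat-∼ ψ Ref
  Sat-∼ (φ ∨′ ψ)   Ref = Sat-∼ φ Ref ⊎-⇔ Sat-∼ ψ Ref
  Sat-∼ (φ ⇒′ ψ)   Ref = →-cong-⇔ (Sat-∼ φ Ref) (Sat-∼ ψ Ref)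
  Sat-∼ (∀′ φ) {e} {f} Ref = mk⇔
    (λ h b → let a , Rab = surjective b in to (Sat-∼ φ (extend {e = e} {f} Rab Ref)) (h a))
    (λ h a → let b , Rab = total a in from (Sat-∼ φ (extend {e = e} {f} Rab Ref)) (h b))
  Sat-∼ (∃′ φ) {e} {f} Ref = mk⇔
    (λ (a , h) → let b , Rab = total a in b , to (Sat-∼ φ (extend {e = e} {f} Rab Ref)) h)
    (λ (b , h) → let a , Rab = surjective b in a , from (Sat-∼ φ (extend {e = e} {f} Rab Ref)) h)

rename : {σ τ : Vocabulary u} → (σ → τ) → Formula σ n → Formula τ n
rename ρ (atom P x) = atom (ρ P) x
rename ρ falsum     = falsum
rename ρ (φ ∧′ ψ)   = rename ρ φ ∧′ rename ρ ψ
rename ρ (φ ∨′ ψ)   = rename ρ φ ∨′ rename ρ ψ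
rename ρ (φ ⇒′ ψ)   = rename ρ φ ⇒′ rename ρ ψ
rename ρ (∀′ φ)     = ∀′ (rename ρ φ)
rename ρ (∃′ φ)     = ∃′ (rename ρ φ)

module _ {u : Level} {σ τ : Vocabulary u} (ρ : σ ↣ τ) (𝔄 : Structure τ) where
  open Equivalence

  Sat-rename : (φ : Formula σ n) (e : Vec (Dom 𝔄) n) →
               Sat 𝔄 e (rename (Injection.to ρ) φ) ⇔ Sat (reduct ρ 𝔄) e φ
  Sat-rename (atom P x) e = ⇔-refl
  Sat-rename falsum     e = ⇔-refl
  Sat-rename (φ ∧′ ψ)   e = Sat-rename φ e ×-⇔ Sat-rename ψ e
  Sat-rename (φ ∨′ ψ)   e = Sat-rename φ e ⊎-⇔ Sat-rename ψ e
  Sat-rename (φ ⇒′ ψ)   e = →-cong-⇔ (Sat-rename φ e) (Sat-rename ψ e)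
  Sat-rename (∀′ φ)     e = mk⇔
    (λ h a → to (Sat-rename φ (a ∷ e)) (h a))
    (λ h a → from (Sat-rename φ (a ∷ e)) (h a))
  Sat-rename (∃′ φ)     e = mk⇔
    (λ (a , h) → a , to (Sat-rename φ (a ∷ e)) h)
    (λ (a , h) → a , from (Sat-rename φ (a ∷ e)) h)

-- Monadic first-order logic without identity.
𝓛¹⁻ωω : (u : Level) → MonadicLogic u u u
𝓛¹⁻ωω u = record
  { Sentence    = FOSentence
  ; _⊨_         = _⊨FO_
  ; isomorphism = λ i φ → Sat-∼ (proj₂ (≅⇒∼ i)) φ (λ ())
  ; translation = λ ρ φ → rename (Injection.to ρ) φ , λ 𝔄 → Sat-rename ρ 𝔄 φ []
  ; atoms       = λ φ _ → φ , λ _ → ⇔-refl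
  ; negation    = λ φ → (φ ⇒′ falsum) , λ _ → mk⇔ (λ h x → lower (h x)) (λ h x → lift (h x))
  ; conjunction = λ φ ψ → (φ ∧′ ψ) , λ _ → ⇔-refl
  ; disjunction = λ φ ψ → (φ ∨′ ψ) , λ _ → ⇔-refl
  }

{-# OPTIONS --safe #-}

-- Compactness applied to φ(τ), ¬φ(τ′) and ∀x (P x ↔ P′ x) for all P ∈ τ, where
-- τ′ is a disjoint copy of τ, shows that φ depends on a finite list σ of
-- symbols only, among structures with a common domain.  If 𝔄 and 𝔅 realise the
-- same σ-types, the pairs (a , b) of equal σ-type form a domain carrying a copy
-- of 𝔄 and a copy of 𝔅, up to weak isomorphism, and these copies agree on σ.
-- Hence the truth of φ is determined by the finitely many sentences "t is
-- realised", for t a σ-type, and so φ is a Boolean combination of them.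
module Submission where

open import Defs
open import Level using (Level; suc; _⊔_; Lift; lift; lower)
open import Axiom.ExcludedMiddle using (ExcludedMiddle)
open import Data.Empty using (⊥-elim)
open import Data.Fin.Base using (zero)
open import Data.List.Base using (List; []; _∷_; _++_; map)
open import Data.List.Membership.Propositional using (_∈_)
open import Data.List.Membership.Propositional.Properties using (∈-++⁺ˡ; ∈-++⁺ʳ; ∈-++⁻; ∈-map⁺; ∈-map⁻)
open import Data.List.Relation.Unary.All as All using (All; []; _∷_; head; tail; lookup)
open import Data.List.Relation.Unary.All.Properties using (map⁻)
open import Data.List.Relation.Unary.Any using (here)
open import Data.Nat.Base using (ℕ)
open import Data.Product.Base using (Σ-syntax; ∃-syntax; _×_; _,_; proj₁; proj₂; uncurry)
open import Data.Sum.Base using (_⊎_; inj₁; inj₂; [_,_])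
open import Data.Sum.Properties using (inj₁-injective; inj₂-injective)
open import Data.Unit.Polymorphic.Base using (⊤; tt)
open import Data.Vec.Base using (_∷_; [])
open import Function.Base using (_∘_; id)
open import Function.Bundles using (_⇔_; mk⇔; _↣_; mk↣; module Equivalence)
open import Function.Construct.Identity using (↔-id)
open import Function.Properties.Equivalence using () renaming (refl to ⇔-refl; sym to ⇔-sym)
open import Relation.Binary.PropositionalEquality using (_≡_; refl)
open import Relation.Nullary using (¬_; yes; no)
open import Relation.Nullary.Decidable using (map′; decidable-stable)
open import Relation.Unary using (Pred)

open Equivalence

private
  variable
    u : Level
    n : ℕ
    τ : Vocabulary u

lower-em : ∀ a b → ExcludedMiddle (a ⊔ b) → ExcludedMiddle a
lower-em a b em {A} = map′ lower lift (em {Lift b A})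

¬′ : Formula τ n → Formula τ n
¬′ φ = φ ⇒′ falsum

verum : Formula τ n
verum = ¬′ falsum

_⇔′_ : Formula τ n → Formula τ n → Formula τ n
φ ⇔′ ψ = (φ ⇒′ ψ) ∧′ (ψ ⇒′ φ)

Agree : (𝔄 𝔅 : Structure τ) → List τ → Dom 𝔄 → Dom 𝔅 → Set _
Agree 𝔄 𝔅 σ a b = All (λ P → interp 𝔄 P a ⇔ interp 𝔅 P b) σ

-- One conjunction for each choice of signs. A symbol listed twice also yields contradictory ones,
-- which no element realises.
types : List τ → List (Formula τ 1)
types []      = verum ∷ []
types (P ∷ σ) = map (atom P zero ∧′_) (types σ) ++ map (¬′ (atom P zero) ∧′_) (types σ)

Realises : (𝔄 : Structure τ) → Dom 𝔄 → Formula τ 1 → Set _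
Realises 𝔄 a t = Sat 𝔄 (a ∷ []) t

-- A member of `types σ` fixes the sign of every symbol in `σ`, and both elements obey the same
-- signs.
same-type⇒Agree : (𝔄 𝔅 : Structure τ) (σ : List τ) {a : Dom 𝔄} {b : Dom 𝔅} {t : Formula τ 1} →
                  t ∈ types σ → Realises 𝔄 a t → Realises 𝔅 b t → Agree 𝔄 𝔅 σ a b
same-type⇒Agree 𝔄 𝔅 []      t∈ p q = []
same-type⇒Agree 𝔄 𝔅 (P ∷ σ) t∈ p q with ∈-++⁻ (map (atom P zero ∧′_) (types σ)) t∈
... | inj₁ t∈⁺ with _ , t′∈ , refl ← ∈-map⁻ _ t∈⁺ =
  mk⇔ (λ _ → proj₁ q) (λ _ → proj₁ p) ∷ same-type⇒Agree 𝔄 𝔅 σ t′∈ (proj₂ p) (proj₂ q)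
... | inj₂ t∈⁻ with _ , t′∈ , refl ← ∈-map⁻ _ t∈⁻ =
  mk⇔ (λ h → ⊥-elim (lower (proj₁ p h))) (λ h → ⊥-elim (lower (proj₁ q h)))
  ∷ same-type⇒Agree 𝔄 𝔅 σ t′∈ (proj₂ p) (proj₂ q)

module _ {u : Level} {τ : Vocabulary u} (em : ExcludedMiddle u) (𝔄 : Structure τ) where

  has-type : (σ : List τ) (a : Dom 𝔄) → ∃[ t ] t ∈ types σ × Realises 𝔄 a t
  has-type []      a = verum , here refl , id
  has-type (P ∷ σ) a with has-type σ a | em {interp 𝔄 P a}
  ... | t , t∈ , p | yes Pa = _ , ∈-++⁺ˡ (∈-map⁺ _ t∈) , Pa , p
  ... | t , t∈ , p | no ¬Pa = _ , ∈-++⁺ʳ _ (∈-map⁺ _ t∈) , lift ∘ ¬Pa , p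

  same-realised-types : (𝔅 : Structure τ) (σ : List τ) →
                        All (λ t → 𝔄 ⊨FO ∃′ t → 𝔅 ⊨FO ∃′ t) (types σ) →
                        ∀ a → ∃[ b ] Agree 𝔄 𝔅 σ a b
  same-realised-types 𝔅 σ h a =
    let t , t∈ , p = has-type σ a
        b , q      = lookup h t∈ (a , p)
    in b , same-type⇒Agree 𝔄 𝔅 σ t∈ p q

-- H is the part of the truth assignment to the original list already fixed by
-- the recursion.
boolean-combination :
  ∀ {u k} {τ : Vocabulary u} → ExcludedMiddle u → ExcludedMiddle (suc u ⊔ k) →
  (K : Pred (Structure τ) k) (H : Pred (Structure τ) u) (βs : List (FOSentence τ)) →
  (∀ 𝔄 𝔅 → H 𝔄 → H 𝔅 → All (λ β → 𝔄 ⊨FO β ⇔ 𝔅 ⊨FO β) βs → K 𝔄 → K 𝔅) →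
  Σ[ ψ ∈ FOSentence τ ] (∀ 𝔄 → H 𝔄 → K 𝔄 ⇔ 𝔄 ⊨FO ψ)
-- With no sentence left, `inv` makes `K` constant on `H`, so a single structure in both settles the
-- value.
boolean-combination em em⁺ K H [] inv with em⁺ {∃[ 𝔄 ] H 𝔄 × K 𝔄}
... | yes (𝔄 , h , k) = verum , λ 𝔅 h′ → mk⇔ (λ _ → id) (λ _ → inv 𝔄 𝔅 h h′ [] k)
... | no ∄ = falsum , λ 𝔅 h′ → mk⇔ (λ k → ⊥-elim (∄ (𝔅 , h′ , k))) (⊥-elim ∘ lower)
boolean-combination {τ = τ} em em⁺ K H (β ∷ βs) inv = ψ , λ 𝔄 h → mk⇔ (K⇒ψ 𝔄 h) (ψ⇒K 𝔄 h)
  where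
  positive = boolean-combination em em⁺ K (λ 𝔄 → H 𝔄 × 𝔄 ⊨FO β) βs
    λ 𝔄 𝔅 (h , p) (h′ , q) e → inv 𝔄 𝔅 h h′ (mk⇔ (λ _ → q) (λ _ → p) ∷ e)
  negative = boolean-combination em em⁺ K (λ 𝔄 → H 𝔄 × ¬ 𝔄 ⊨FO β) βs
    λ 𝔄 𝔅 (h , p) (h′ , q) e →
      inv 𝔄 𝔅 h h′ (mk⇔ (λ x → ⊥-elim (p x)) (λ x → ⊥-elim (q x)) ∷ e)

  ψ : FOSentence τ
  ψ = (β ∧′ proj₁ positive) ∨′ (¬′ β ∧′ proj₁ negative)

  K⇒ψ : ∀ 𝔄 → H 𝔄 → K 𝔄 → 𝔄 ⊨FO ψ
  K⇒ψ 𝔄 h k with em {𝔄 ⊨FO β}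
  ... | yes p = inj₁ (p , to (proj₂ positive 𝔄 (h , p)) k)
  ... | no ¬p = inj₂ (lift ∘ ¬p , to (proj₂ negative 𝔄 (h , ¬p)) k)

  ψ⇒K : ∀ 𝔄 → H 𝔄 → 𝔄 ⊨FO ψ → K 𝔄
  ψ⇒K 𝔄 h (inj₁ (p , x)) = from (proj₂ positive 𝔄 (h , p)) x
  ψ⇒K 𝔄 h (inj₂ (p , x)) = from (proj₂ negative 𝔄 (h , lower ∘ p)) x

pullback : (𝔄 : Structure {u} τ) {D : Set u} → D → (D → Dom 𝔄) → Structure τ
pullback 𝔄 {D} d f = record { Dom = D ; point = d ; interp = λ P → interp 𝔄 P ∘ f }

-- The graph of `f` works, since symbols on `D` are read through `f`; thus elements may be
-- duplicated at will.
pullback-∼ : (𝔄 : Structure {u} τ) {D : Set u} (d : D) (f : D → Dom 𝔄) →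
             (∀ a → ∃[ x ] f x ≡ a) → pullback 𝔄 d f ∼ 𝔄
pullback-∼ 𝔄 d f surj = (λ x a → f x ≡ a) , record
  { total      = λ x → f x , refl
  ; surjective = surj
  ; preserves  = λ { refl _ → ⇔-refl }
  }

-- The reducts along `inj₁` and `inj₂` are definitionally `𝔄` and `𝔄` reinterpreted by `I`, so truth
-- of `φ` carries over directly.
_⊎ˢ_ : (𝔄 : Structure {u} τ) → (τ → Pred (Dom 𝔄) u) → Structure (τ ⊎ τ)
𝔄 ⊎ˢ I = record { Dom = Dom 𝔄 ; point = point 𝔄 ; interp = [ interp 𝔄 , I ] }

module _ {u s r : Level} (em : ExcludedMiddle (suc u ⊔ s ⊔ r)) (L : MonadicLogic u s r)
         (FO≤L : 𝓛¹⁻ωω u ≤ L) where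
  open MonadicLogic L

  module _ {τ : Vocabulary u} (φ : Sentence τ) where

    private
      ι₁ ι₂ : τ ↣ (τ ⊎ τ)
      ι₁ = mk↣ inj₁-injective
      ι₂ = mk↣ inj₂-injective

      φ₁ = translation ι₁ φ
      φ₂ = translation ι₂ φ
      ¬φ₂ = negation (proj₁ φ₂)

      -- The closure properties of `L` include no quantification, so this sentence comes from
      -- `FO≤L`.
      coincide : (P : τ) → Σ[ ψ ∈ Sentence (τ ⊎ τ) ]
        (∀ 𝔄 → 𝔄 ⊨FO ∀′ (atom (inj₁ P) zero ⇔′ atom (inj₂ P) zero) ⇔ 𝔄 ⊨ ψ)
      coincide P = FO≤L (τ ⊎ τ) (∀′ (atom (inj₁ P) zero ⇔′ atom (inj₂ P) zero))

    -- Inductive, so that a membership proof remembers its `P`; `symbols` extracts it.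
    data Separation : Pred (Sentence (τ ⊎ τ)) (u ⊔ s) where
      first  : Separation (proj₁ φ₁)
      second : Separation (proj₁ ¬φ₂)
      common : (P : τ) → Separation (proj₁ (coincide P))

    -- In a model the `common` sentences turn the identity map into an isomorphism of the two
    -- reducts, which disagree on `φ`.
    Separation-inconsistent : ¬ HasModel L Separation
    Separation-inconsistent (ℭ , m) =
      to (proj₂ ¬φ₂ ℭ) (m _ second) (from (proj₂ φ₂ ℭ) (to (isomorphism iso φ) (to (proj₂ φ₁ ℭ) (m _ first))))
      where
      iso : reduct ι₁ ℭ ≅ reduct ι₂ ℭ
      iso = record
        { bijection = ↔-id _
        ; preserves = λ P a → uncurry mk⇔ (from (proj₂ (coincide P) ℭ) (m _ (common P)) a)
        }

    symbols : {Φ : List (Sentence (τ ⊎ τ))} → All Separation Φ → List τ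
    symbols []              = []
    symbols (first    ∷ hs) = symbols hs
    symbols (second   ∷ hs) = symbols hs
    symbols (common P ∷ hs) = P ∷ symbols hs

    module _ (𝔄 : Structure τ) (I : τ → Pred (Dom 𝔄) u) where

      private
        𝔅 : Structure τ
        𝔅 = record 𝔄 { interp = I }

      Separation-model : 𝔄 ⊨ φ → ¬ 𝔅 ⊨ φ → {Φ : List (Sentence (τ ⊎ τ))} (hs : All Separation Φ) →
                         (∀ a → Agree 𝔄 𝔅 (symbols hs) a a) → All ((𝔄 ⊎ˢ I) ⊨_) Φ
      Separation-model p q []              e = []
      Separation-model p q (first ∷ hs)    e = from (proj₂ φ₁ _) p ∷ Separation-model p q hs e
      Separation-model p q (second ∷ hs)   e =
        from (proj₂ ¬φ₂ _) (q ∘ to (proj₂ φ₂ _)) ∷ Separation-model p q hs e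
      Separation-model p q (common P ∷ hs) e =
        to (proj₂ (coincide P) _) (λ a → to (head (e a)) , from (head (e a)))
        ∷ Separation-model p q hs (λ a → tail (e a))

    -- By compactness some finite part of `Separation` has no model. Its `symbols` serve as `σ`: a
    -- counterexample would give that part a model by `Separation-model`.
    finite-dependence : CompactnessProperty L →
      Σ[ σ ∈ List τ ] (∀ (𝔄 : Structure τ) (I : τ → Pred (Dom 𝔄) u) → let 𝔅 = record 𝔄 { interp = I } in
        (∀ a → Agree 𝔄 𝔅 σ a a) → 𝔄 ⊨ φ → 𝔅 ⊨ φ)
    finite-dependence compact
      with em {Σ[ Φ ∈ List (Sentence (τ ⊎ τ)) ] All Separation Φ × ¬ (Σ[ 𝔄 ∈ Structure (τ ⊎ τ) ] All (𝔄 ⊨_) Φ)}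
    ... | yes (Φ , hs , ∄) = symbols hs , λ 𝔄 I e p →
      decidable-stable (lower-em r (suc u ⊔ s) em) (λ q → ∄ (𝔄 ⊎ˢ I , Separation-model 𝔄 I p q hs e))
    ... | no ∄ = ⊥-elim (Separation-inconsistent (compact (τ ⊎ τ) Separation λ Φ hs →
      decidable-stable em (λ q → ∄ (Φ , hs , q))))

  type-invariance : CompactnessProperty L → WeakIsomorphismProperty L →
    {τ : Vocabulary u} (φ : Sentence τ) → Σ[ σ ∈ List τ ] (∀ 𝔄 𝔅 →
      (∀ a → ∃[ b ] Agree 𝔄 𝔅 σ a b) → (∀ b → ∃[ a ] Agree 𝔄 𝔅 σ a b) → 𝔄 ⊨ φ → 𝔅 ⊨ φ)
  type-invariance compact weak {τ} φ = σ , invariant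
    where
    σ : List τ
    σ = proj₁ (finite-dependence φ compact)

    invariant : ∀ 𝔄 𝔅 → (∀ a → ∃[ b ] Agree 𝔄 𝔅 σ a b) → (∀ b → ∃[ a ] Agree 𝔄 𝔅 σ a b) →
                𝔄 ⊨ φ → 𝔅 ⊨ φ
    invariant 𝔄 𝔅 forth back p =
      -- Innermost first: from `𝔄` to its copy on `Pairs`, across to the copy of `𝔅`, then down to
      -- `𝔅`. `forth` and `back` make the projections surjective.
      to (weak τ _ 𝔅 (pullback-∼ 𝔅 pt right λ b → let a , e = back b in (a , b , e) , refl) φ)
        (proj₂ (finite-dependence φ compact) (pullback 𝔄 pt left) (λ P → interp 𝔅 P ∘ right)
          -- Each pair carries its own proof of agreement.
          (proj₂ ∘ proj₂)
          (from (weak τ _ 𝔄 (pullback-∼ 𝔄 pt left λ a → let b , e = forth a in (a , b , e) , refl) φ) p))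
      where
      Pairs : Set u
      Pairs = ∃[ a ] ∃[ b ] Agree 𝔄 𝔅 σ a b
      left : Pairs → Dom 𝔄
      left = proj₁
      right : Pairs → Dom 𝔅
      right = proj₁ ∘ proj₂
      pt : Pairs
      pt = point 𝔄 , forth (point 𝔄)

theorem9 : ∀ {u s r : Level} → ExcludedMiddle (suc u ⊔ s ⊔ r) →
    (L : MonadicLogic u s r) → 𝓛¹⁻ωω u ≤ L →
    CompactnessProperty L → WeakIsomorphismProperty L →
    L ≤ 𝓛¹⁻ωω u
theorem9 {u} {s} {r} em L FO≤L compact weak τ φ =
  let ψ , equiv = boolean-combination em-u (lower-em (suc u ⊔ r) s em) (_⊨ φ)
        -- `H` starts trivial: no truth value is fixed yet.
        (λ _ → ⊤) (map ∃′ (types σ)) λ 𝔄 𝔅 _ _ e →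
          proj₂ dependence 𝔄 𝔅
            (same-realised-types em-u 𝔄 𝔅 σ (All.map to (map⁻ e)))
            -- The back condition is the forth condition with `𝔄` and `𝔅` exchanged, so the
            -- agreement has to be reversed.
            (λ b → let a , e′ = same-realised-types em-u 𝔅 𝔄 σ (All.map from (map⁻ e)) b
                   in a , All.map ⇔-sym e′)
  in ψ , λ 𝔄 → equiv 𝔄 tt
  where
  open MonadicLogic L using (_⊨_)
  em-u : ExcludedMiddle u
  em-u = lower-em u (suc u ⊔ s ⊔ r) em
  dependence = type-invariance em L FO≤L compact weak φ
  σ : List τ
  σ = proj₁ dependence
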